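{- Let $G$ be a connected chordal graph with at least two vertices. A vertex $v\in V(G)$ is an $\mathcal{F}$-branch leaf of some BFS ordering of $G$ if and only if the radius of the induced subgraph $G[N_G(v)]$ is at most two.
   Context: Graphs are finite, simple, undirected; $N_G(v)$ is the open neighborhood of $v$. A graph is chordal if it has no induced cycle of length at least 4. The eccentricity of a vertex is its largest distance to any other vertex, and the radius of a graph is the smallest eccentricity of its vertices (infinite if the graph is disconnected). A vertex ordering of $G$ is a bijection $\sigma:\{1,\dots,n\}\to V(G)$; $u\prec_\sigma w$ means $u$ comes before $w$. BFS orderings are produced by the label search: initially all labels are $\emptyset$; for $i=1,\dots,n$ choose any unnumbered vertex $x$ such that there is no unnumbered $y$ with $\mathrm{label}(x)\prec\mathrm{label}(y)$, set $\sigma(i)=x$, and add $i$ to the labels of the unnumbered neighbors of $x$, where $A\prec B$ iff ($A=\emptyset$ and $B\neq\emptyset$) or $\min(A)>\min(B)$. The $\mathcal{F}$-tree of $\sigma$ is the spanning tree containing, for each $v\neq\sigma(1)$, the edge from $v$ to its leftmost neighbor in $\sigma$. A vertex $v\neq\sigma(1)$ that is a leaf of the $\mathcal{F}$-tree is an $\mathcal{F}$-branch leaf of $\sigma$. -}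

module Defs where

open import Data.Bool.Base using (Bool; T; _∧_; if_then_else_)
open import Data.Fin.Base as Fin using (Fin; toℕ; fromℕ<)
open import Data.Fin.Permutation using (Permutation′; _⟨$⟩ʳ_; _⟨$⟩ˡ_)
open import Data.Fin.Properties using (toℕ<n; _<?_)
open import Data.Fin.Subset using (Subset; _∈_; _∪_; ⁅_⁆; Nonempty; Empty) renaming (⊥ to ∅)
open import Data.Nat.Base using (ℕ; zero; suc; _≤_)
open import Data.Nat.Properties using (<⇒≤)
open import Data.Product.Base using (∃-syntax; ∃₂; _×_; proj₁)
open import Data.Sum.Base using (_⊎_)
open import Function.Bundles using (_⇔_)
open import Function.Definitions using (Injective)
open import Relation.Binary.Construct.Add.Supremum.NonStrict _≤_ public using () renaming (_≤⁺_ to _≤∞_)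
open import Relation.Binary.PropositionalEquality.Core using (_≡_)
open import Relation.Nullary.Construct.Add.Supremum public using (_⁺; [_]; ⊤⁺)
open import Relation.Nullary.Decidable.Core using (does)
open import Relation.Nullary.Negation.Core using (¬_)

-- Adjacency is Boolean so that membership in a neighbourhood is
-- proof-irrelevant: each vertex of S then occurs exactly once in G ⟦ S ⟧.
-- Finite graphs are those of type Graph (Fin n).
record Graph (V : Set) : Set where
  field
    adj    : V → V → Bool
    sym    : ∀ {u w} → T (adj u w) → T (adj w u)
    irrefl : ∀ {u} → ¬ T (adj u u)

  Adj : V → V → Set
  Adj u w = T (adj u w)

  N : V → V → Bool
  N v = adj v

open Graph public using (Adj; N)

_⟦_⟧ : ∀ {V} → Graph V → (S : V → Bool) → Graph (∃[ u ] T (S u))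
G ⟦ S ⟧ = record
  { adj    = λ u w → Graph.adj G (proj₁ u) (proj₁ w)
  ; sym    = Graph.sym G
  ; irrefl = Graph.irrefl G
  }

ℕ∞ : Set
ℕ∞ = ℕ ⁺

module _ {V : Set} (G : Graph V) where

  data Walk : V → V → ℕ → Set where
    nil  : ∀ {u} → Walk u u zero
    cons : ∀ {u v w k} → Adj G u v → Walk v w k → Walk u w (suc k)

  Connected : Set
  Connected = ∀ u w → ∃[ k ] Walk u w k

  IsDistance : V → V → ℕ∞ → Set
  IsDistance u w [ k ] = Walk u w k × (∀ j → Walk u w j → k ≤ j)
  IsDistance u w ⊤⁺    = ∀ k → ¬ Walk u w k

  -- The maximum includes the distance 0 from v to itself, so the
  -- eccentricity of the vertex of a one-vertex graph is 0.
  IsEccentricity : V → ℕ∞ → Set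
  IsEccentricity v e =
    (∃[ u ] IsDistance v u e) × (∀ u d → IsDistance v u d → d ≤∞ e)

  IsRadius : ℕ∞ → Set
  IsRadius r =
    (∃[ v ] IsEccentricity v r) × (∀ v e → IsEccentricity v e → r ≤∞ e)

  RadiusAtMost : ℕ → Set
  RadiusAtMost k = ∃[ r ] IsRadius r × r ≤∞ [ k ]

Next : ∀ {k} → Fin k → Fin k → Set
Next {k} i j = (toℕ j ≡ suc (toℕ i)) ⊎ (suc (toℕ i) ≡ k × toℕ j ≡ 0)

InducedCycle : ∀ {V} → Graph V → ℕ → Set
InducedCycle {V} G k = ∃[ c ] Injective {A = Fin k} {B = V} _≡_ _≡_ c
                            × (∀ i j → Adj G (c i) (c j) ⇔ (Next i j ⊎ Next j i))

Chordal : ∀ {V} → Graph V → Set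
Chordal G = ∀ k → 4 ≤ k → ¬ InducedCycle G k

-- Positions are numbered from 0: σ ⟨$⟩ʳ i is the vertex in position i,
-- and σ ⟨$⟩ˡ v is the position of v.
VertexOrdering : ℕ → Set
VertexOrdering = Permutation′

IsMin : ∀ {n} → Subset n → Fin n → Set
IsMin A m = m ∈ A × (∀ i → i ∈ A → m Fin.≤ i)

-- The second alternative requires both minima to exist.
_≺_ : ∀ {n} → Subset n → Subset n → Set
A ≺ B = (Empty A × Nonempty B) ⊎ (∃₂ λ a b → IsMin A a × IsMin B b × b Fin.< a)

module _ {n : ℕ} (G : Graph (Fin n)) (σ : VertexOrdering n) where

  -- The labels after the first k steps of the search that produces σ.  In
  -- step i the vertex σ ⟨$⟩ʳ i is numbered, so the vertices still unnumbered
  -- after that step are those in positions greater than i.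
  labels : (k : ℕ) → .(k ≤ n) → Fin n → Subset n
  labels zero    _   y = ∅
  labels (suc k) k<n y =
    let i   = fromℕ< k<n
        old = labels k (<⇒≤ k<n) y
    in if does (i <? (σ ⟨$⟩ˡ y)) ∧ Graph.adj G (σ ⟨$⟩ʳ i) y
       then old ∪ ⁅ i ⁆
       else old

  labelAt : Fin n → Fin n → Subset n
  labelAt i = labels (toℕ i) (<⇒≤ (toℕ<n i))

  IsBFS : Set
  IsBFS = ∀ i → ¬ (∃[ y ] i Fin.≤ (σ ⟨$⟩ˡ y) × labelAt i (σ ⟨$⟩ʳ i) ≺ labelAt i y)

  IsFirst : Fin n → Set
  IsFirst v = toℕ (σ ⟨$⟩ˡ v) ≡ 0

  IsLeftmostNeighbour : Fin n → Fin n → Set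
  IsLeftmostNeighbour v w =
    Adj G v w × (∀ u → Adj G v u → (σ ⟨$⟩ˡ w) Fin.≤ (σ ⟨$⟩ˡ u))

  FArc : Fin n → Fin n → Set
  FArc v w = ¬ IsFirst v × IsLeftmostNeighbour v w

  FTreeEdge : Fin n → Fin n → Set
  FTreeEdge v w = FArc v w ⊎ FArc w v

  IsFTreeLeaf : Fin n → Set
  IsFTreeLeaf v = ∃[ w ] FTreeEdge v w × (∀ u → FTreeEdge v u → u ≡ w)

  IsFBranchLeaf : Fin n → Set
  IsFBranchLeaf v = ¬ IsFirst v × IsFTreeLeaf v

{-# OPTIONS --safe #-}

-- If v is a branch leaf, its leftmost neighbour p is a centre of N(v).  Let
-- u ∈ N(v) have leftmost neighbour q; as q ≠ v, q precedes v.  In a chordal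
-- graph two neighbours of w joined by a path whose interior avoids the closed
-- neighbourhood of w are adjacent, and every initial segment of a BFS ordering
-- is connected.  With w = v and the vertices before p this gives u ∼ p when q
-- precedes p; with w = u and the vertices before q it gives q ∼ v when p
-- precedes q, and then q ∼ p, so that p, q, u is a walk in N(v).
--
-- Conversely, a BFS started at a centre c of N(v) that breaks ties against v
-- reaches v last among the neighbours of c.  Each neighbour of v is then c, a
-- neighbour of c, or adjacent to a neighbour of c before v, so v is a leaf.

module Submission where

open import Defs
open import Data.Bool.Base using (Bool; true; false; T; _∧_; if_then_else_)
open import Data.Bool.Properties using (T-irrelevant; T-∧)
open import Data.Fin.Base as Fin using (Fin; zero; suc; toℕ; fromℕ<)
open import Data.Fin.Permutation using (_⟨$⟩ʳ_; _⟨$⟩ˡ_; inverseʳ; inverseˡ; transpose; _∘ₚ_)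
open import Data.Fin.Properties using (any?; toℕ-injective; toℕ<n; toℕ-fromℕ<; _<?_)
  renaming (_≟_ to _≟ᶠ_; _≤?_ to _≤ᶠ?_)
open import Data.Fin.Subset using (Subset; _∈_; _∪_; ⁅_⁆; Nonempty)
open import Data.Fin.Subset.Properties
  using (_∈?_; nonempty?; x∈p∪q⁻; x∈p∪q⁺; x∈⁅x⁆; x∈⁅y⁆⇒x≡y; ∉⊥)
open import Data.Nat.Base using (ℕ; zero; suc; _+_; _≤_; _<_; z≤n; s≤s; s≤s⁻¹)
open import Data.Nat.Induction using (<-wellFounded)
open import Data.Nat.Properties as ℕ using (anyUpTo?; ≮⇒≥; ≰⇒>; ≤-refl; ≤-trans; ≤-antisym; <⇒≤;
  <-irrefl; <-≤-trans; ≤-<-trans; <-trans; m≤n⇒m<n∨m≡n)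
open import Data.Product.Base using (∃; ∃-syntax; _×_; _,_; proj₁; proj₂)
open import Data.Sum.Base using (_⊎_; inj₁; inj₂)
open import Data.Unit.Base using (tt)
open import Function.Base using (_∘_; id; case_of_)
open import Function.Bundles using (_⇔_; mk⇔; Equivalence)
open import Induction.WellFounded using (Acc; acc)
open import Relation.Binary.Construct.Add.Supremum.NonStrict _≤_ using ([_]; _≤⊤⁺)
open import Relation.Binary.Definitions using (DecidableEquality; tri<; tri≈; tri>)
open import Relation.Binary.PropositionalEquality
  using (_≡_; _≢_; refl; sym; trans; cong; subst; subst₂)
open import Relation.Nullary using (¬_; Dec; yes; no; contradiction)
open import Relation.Nullary.Decidable using (does; map′; ¬?; _×-dec_; decidable-stable; T?)
open import Relation.Unary using (Decidable)

-- Least witnesses by descent.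

-- Decisions are required only below a bound, so that the descent also serves infinite types such as
-- `ℕ`.
minimiser : ∀ {A : Set} {P : A → Set} (f : A → ℕ) →
  (∀ b → Dec (∃[ y ] f y < b × P y)) → ∃ P → ∃[ m ] P m × (∀ y → P y → f m ≤ f y)
minimiser {A} {P} f below? (x₀ , px₀) = descend x₀ px₀ (<-wellFounded (f x₀))
  where
  descend : ∀ x → P x → Acc _<_ (f x) → ∃[ m ] P m × (∀ y → P y → f m ≤ f y)
  descend x px (acc rec) with below? (f x)
  ... | yes (y , y<x , py) = descend y py (rec y<x)
  ... | no none = x , px , λ y py → ≮⇒≥ (λ y<x → none (y , y<x , py))

leastNat : ∀ {P : ℕ → Set} → Decidable P → ∃ P → ∃[ m ] P m × (∀ j → P j → m ≤ j)
leastNat P? = minimiser id (anyUpTo? P?)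

minimiserFin : ∀ {n} {P : Fin n → Set} → Decidable P → (f : Fin n → ℕ) →
  ∃ P → ∃[ m ] P m × (∀ y → P y → f m ≤ f y)
minimiserFin P? f = minimiser f (λ b → any? (λ y → (f y ℕ.<? b) ×-dec P? y))

-- Radius at most k as the existence of a centre.

module _ {V : Set} (H : Graph V) where

  -- The strict bound `j < suc k` is the form that `anyUpTo?` decides.
  Within : ℕ → V → V → Set
  Within k u w = ∃[ j ] j < suc k × Walk H u w j

  Centre : ℕ → V → Set
  Centre k c = ∀ u → Within k c u

module Radius {V : Set} (H : Graph V) (_≟_ : DecidableEquality V)
  (search : ∀ {P : V → Set} → Decidable P → Dec (∃ P)) where

  walk? : ∀ u w k → Dec (Walk H u w k)
  walk? u w zero = map′ (λ { refl → nil }) (λ { nil → refl }) (u ≟ w)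
  walk? u w (suc k) = map′ (λ (v , e , p) → cons e p) (λ { (cons e p) → _ , e , p })
    (search (λ v → T? _ ×-dec walk? v w k))

  within? : ∀ k u w → Dec (Within H k u w)
  within? k u w = anyUpTo? (walk? u w) (suc k)

  centre? : ∀ k → Decidable (Centre H k)
  centre? k c = map′ (λ none u → decidable-stable (within? k c u) (λ far → none (u , far)))
    (λ cen (u , far) → far (cen u)) (¬? (search (λ u → ¬? (within? k c u))))

  distance : ∀ {u w k} → Walk H u w k → ∃[ d ] IsDistance H u w [ d ]
  distance p = leastNat (walk? _ _) (_ , p)

  -- A walk to a far `u` would yield a finite distance, at most `m`, so that `u` would not be far.
  -- Hence a far `u` is unreachable, and its distance `⊤⁺` exceeds `[ m ]`.
  eccentricity⇒centre : ∀ {c m} → IsEccentricity H c [ m ] → Centre H m c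
  eccentricity⇒centre {c} {m} (_ , upper) u = decidable-stable (within? m c u) λ far →
    case upper u ⊤⁺ (λ k p → let (d , shortest) = distance p in
                     case upper u [ d ] shortest of λ { [ d≤m ] → far (d , s≤s d≤m , proj₁ shortest) })
    of λ ()

  centre⇒eccentricity : ∀ {c k} → Centre H k c → (∀ m → Centre H m c → k ≤ m) → IsEccentricity H c [ k ]
  centre⇒eccentricity {c} {k} cen least = attained , upper
    where
    upper : ∀ u d → IsDistance H c u d → d ≤∞ [ k ]
    upper u [ d ] (_ , shortest) =
      let (j , j≤k , p) = cen u in [ ≤-trans (shortest j p) (s≤s⁻¹ j≤k) ]
    upper u ⊤⁺ unreachable = let (j , _ , p) = cen u in contradiction p (unreachable j)

    -- If every vertex were nearer than `k`, then `c` would be a centre for `k - 1`, against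
    -- minimality; for `k = 0` nothing is that near.
    closer⇒⊥ : ∀ k → (∀ m → Centre H m c → k ≤ m) → ¬ (∀ u → ∃[ j ] j < k × Walk H c u j)
    closer⇒⊥ zero _ near = case near c of λ ()
    closer⇒⊥ (suc k) least near = <-irrefl refl (least k near)

    attained : ∃[ u ] IsDistance H c u [ k ]
    attained with search (λ u → ¬? (anyUpTo? (walk? c u) k))
    ... | no none = contradiction
            (λ u → decidable-stable (anyUpTo? (walk? c u) k) (λ far → none (u , far)))
            (closer⇒⊥ k least)
    ... | yes (u , far) =
          u , subst (Walk H c u) (≤-antisym (s≤s⁻¹ j≤k) (shortest j p)) p , shortest
            where
            shortest : ∀ j → Walk H c u j → k ≤ j
            shortest j q = ≮⇒≥ (λ j<k → far (j , j<k , q))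
            j = proj₁ (cen u)
            j≤k = proj₁ (proj₂ (cen u))
            p = proj₂ (proj₂ (cen u))

  radius⇒centre : ∀ {k} → RadiusAtMost H k → ∃[ c ] Centre H k c
  radius⇒centre ([ r ] , ((c , ecc) , _) , [ r≤k ]) =
    c , λ u → let (j , j≤r , p) = eccentricity⇒centre ecc u in j , ≤-trans j≤r (s≤s r≤k) , p

  -- The radius is found as the least `m` for which some centre exists, which avoids comparing
  -- eccentricities.
  centre⇒radius : ∀ {k c} → Centre H k c → RadiusAtMost H k
  centre⇒radius {k} {c} cen with leastNat (λ m → search (centre? m)) (k , c , cen)
  ... | r , (z , cenᶻ) , least =
        [ r ] , ((z , centre⇒eccentricity cenᶻ (λ m q → least m (z , q))) , lower) , [ least k (c , cen) ]
    where
    lower : ∀ v e → IsEccentricity H v e → [ r ] ≤∞ e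
    lower v [ m ] ecc = [ least m (v , eccentricity⇒centre ecc) ]
    lower v ⊤⁺ _ = _ ≤⊤⁺

module _ {n : ℕ} (S : Fin n → Bool) where

  _≟ₛ_ : DecidableEquality (∃[ u ] T (S u))
  (u , p) ≟ₛ (w , q) with u ≟ᶠ w
  ... | no u≢w = no (u≢w ∘ cong proj₁)
  ... | yes refl = yes (cong (u ,_) (T-irrelevant p q))

  searchₛ : ∀ {P : ∃[ u ] T (S u) → Set} → Decidable P → Dec (∃ P)
  searchₛ {P} P? = map′ (λ (u , t , p) → (u , t) , p) (λ ((u , t) , p) → u , t , p)
    (any? (λ u → over (S u) (λ t → P? (u , t))))
    where
    -- The Boolean is generalised so that it can be matched on; membership then has one proof or
    -- none.
    over : ∀ b {Q : T b → Set} → Decidable Q → Dec (∃ Q)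
    over true Q? = map′ (tt ,_) proj₂ (Q? tt)
    over false Q? = no λ ()

-- Paths, and adjacency of neighbours in chordal graphs.

module _ {V : Set} (G : Graph V) where

  -- Paths as functions on indices, the form in which chords are cut off; the inductive `Path` below
  -- is the form in which paths are built. `P` constrains inner vertices only.
  record IsPath (P : V → Set) (a b : V) (k : ℕ) (f : ℕ → V) : Set where
    field
      start : f 0 ≡ a
      end   : f k ≡ b
      step  : ∀ {i} → i < k → Adj G (f i) (f (suc i))
      inner : ∀ {i} → 0 < i → i < k → P (f i)

  open IsPath

  data Path (P : V → Set) (a b : V) : Set where
    edge : Adj G a b → Path P a b
    cons : ∀ {u} → Adj G a u → P u → Path P u b → Path P a b

  join : ∀ {P a u b} → Path P a u → P u → Path P u b → Path P a b
  join (edge e) pu q = cons e pu q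
  join (cons e px p) pu q = cons e px (join p pu q)

  reverse : ∀ {P a b} → Path P a b → Path P b a
  reverse (edge e) = edge (Graph.sym G e)
  reverse (cons e pu p) = join (reverse p) pu (edge (Graph.sym G e))

  vertexAt : ∀ {P a b} → Path P a b → ℕ → V
  vertexAt {a = a} _ zero = a
  -- Index 1 is the true end; larger indices repeat `b` as a default.
  vertexAt {b = b} (edge _) (suc _) = b
  vertexAt (cons _ _ p) (suc i) = vertexAt p i

  pathLength : ∀ {P a b} → Path P a b → ℕ
  pathLength (edge _) = 1
  pathLength (cons _ _ p) = suc (pathLength p)

  isPath : ∀ {P a b} (p : Path P a b) → IsPath P a b (pathLength p) (vertexAt p)
  isPath {P} {a} {b} p = record { start = refl ; end = end′ p ; step = step′ p ; inner = inner′ p }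
    where
    end′ : ∀ {a} (p : Path P a b) → vertexAt p (pathLength p) ≡ b
    end′ (edge _) = refl
    end′ (cons _ _ p) = end′ p
    step′ : ∀ {a} (p : Path P a b) {i} → i < pathLength p → Adj G (vertexAt p i) (vertexAt p (suc i))
    step′ (edge e) {zero} _ = e
    step′ (edge e) {suc i} (s≤s ())
    step′ (cons e _ p) {zero} _ = e
    step′ (cons _ _ p) {suc i} (s≤s lt) = step′ p lt
    inner′ : ∀ {a} (p : Path P a b) {i} → 0 < i → i < pathLength p → P (vertexAt p i)
    inner′ (edge _) {suc i} _ (s≤s ())
    inner′ (cons _ pu p) {suc zero} _ _ = pu
    inner′ (cons _ _ p) {suc (suc i)} _ (s≤s lt) = inner′ p (s≤s z≤n) lt

  splice : ℕ → ℕ → (ℕ → V) → ℕ → V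
  splice i d f m with m ℕ.≤? i
  ... | yes _ = f m
  ... | no _ = f (m + d)

  splice-path : ∀ {P a b i d k f} → IsPath P a b (k + d) f → i < k →
    Adj G (f i) (f (suc i + d)) → IsPath P a b k (splice i d f)
  splice-path {P} {a} {b} {i} {d} {k} {f} path i<k chord = record
    { start = start path ; end = end′ ; step = step′ ; inner = inner′ }
    where
    end′ : splice i d f k ≡ b
    end′ with k ℕ.≤? i
    ... | yes k≤i = contradiction i<k (ℕ.≤⇒≯ k≤i)
    ... | no _ = end path
    step′ : ∀ {m} → m < k → Adj G (splice i d f m) (splice i d f (suc m))
    step′ {m} m<k with m ℕ.≤? i | suc m ℕ.≤? i
    ... | yes _ | yes _ = step path (≤-trans m<k (ℕ.m≤m+n k d))
    -- Only the step at `m ≡ i` crosses the cut, and it is the chord.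
    ... | yes m≤i | no m≮i rewrite ≤-antisym m≤i (≮⇒≥ m≮i) = chord
    ... | no m≰i | yes m<i = contradiction (<⇒≤ m<i) m≰i
    ... | no _ | no _ = step path (ℕ.+-monoˡ-≤ d m<k)
    inner′ : ∀ {m} → 0 < m → m < k → P (splice i d f m)
    inner′ {m} 0<m m<k with m ℕ.≤? i
    ... | yes _ = inner path 0<m (≤-trans m<k (ℕ.m≤m+n k d))
    ... | no _ = inner path (≤-trans 0<m (ℕ.m≤m+n m d)) (ℕ.+-monoˡ-≤ d m<k)

  Distant : V → V → Set
  Distant w u = u ≢ w × ¬ Adj G w u

  module _ {w a b k f} (path : IsPath (Distant w) a b k f)
    (w∼a : Adj G w a) (w∼b : Adj G w b) (a≢b : a ≢ b)
    (chordless : ∀ {i j} → suc i < j → j ≤ k → ¬ Adj G (f i) (f j)) where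

    private
      w∼start : Adj G w (f 0)
      w∼start = subst (Adj G w) (sym (start path)) w∼a

      w∼end : Adj G w (f k)
      w∼end = subst (Adj G w) (sym (end path)) w∼b

      avoids : ∀ {i} → i ≤ k → w ≢ f i
      avoids {zero} _ w≡ = Graph.irrefl G (subst (Adj G w) (sym w≡) w∼start)
      avoids {suc i} i≤k w≡ with m≤n⇒m<n∨m≡n i≤k
      ... | inj₁ i<k = proj₁ (inner path (s≤s z≤n) i<k) (sym w≡)
      ... | inj₂ refl = Graph.irrefl G (subst (Adj G w) (sym w≡) w∼end)

      -- If `f i ≡ f j` with `j < k`, the step leaving `j` is a chord from `i`. If `j ≡ k`, the
      -- repeated vertex is `b`, which is neither `a` nor, being adjacent to `w`, an inner vertex.
      distinct : ∀ {i j} → i < j → j ≤ k → f i ≢ f j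
      distinct {i} {j} i<j j≤k fi≡fj with m≤n⇒m<n∨m≡n j≤k
      ... | inj₁ j<k = chordless (s≤s i<j) j<k
              (subst (λ x → Adj G x (f (suc j))) (sym fi≡fj) (step path j<k))
      distinct {zero} {j} i<j j≤k fi≡fj | inj₂ refl =
        a≢b (trans (sym (start path)) (trans fi≡fj (end path)))
      distinct {suc i} {j} i<j j≤k fi≡fj | inj₂ refl =
        proj₂ (inner path (s≤s z≤n) i<j) (subst (Adj G w) (sym fi≡fj) w∼end)

      injective : ∀ {i j} → i ≤ k → j ≤ k → f i ≡ f j → i ≡ j
      injective {i} {j} i≤k j≤k eq with ℕ.<-cmp i j
      ... | tri< i<j _ _ = contradiction eq (distinct i<j j≤k)
      ... | tri≈ _ i≡j _ = i≡j
      ... | tri> _ _ j<i = contradiction (sym eq) (distinct j<i i≤k)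

      neighbour-of-w : ∀ {i} → i ≤ k → Adj G w (f i) → i ≡ 0 ⊎ i ≡ k
      neighbour-of-w {zero} _ _ = inj₁ refl
      neighbour-of-w {suc i} i≤k e with m≤n⇒m<n∨m≡n i≤k
      ... | inj₁ i<k = contradiction e (proj₂ (inner path (s≤s z≤n) i<k))
      ... | inj₂ i≡k = inj₂ i≡k

      consecutive : ∀ {i j} → i ≤ k → j ≤ k → Adj G (f i) (f j) → j ≡ suc i ⊎ i ≡ suc j
      consecutive {i} {j} i≤k j≤k e with ℕ.<-cmp i j
      ... | tri≈ _ refl _ = contradiction e (Graph.irrefl G)
      ... | tri< i<j _ _ with m≤n⇒m<n∨m≡n i<j
      ...   | inj₁ far = contradiction e (chordless far j≤k)
      ...   | inj₂ eq = inj₁ (sym eq)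
      consecutive {i} {j} i≤k j≤k e | tri> _ _ j<i with m≤n⇒m<n∨m≡n j<i
      ...   | inj₁ far = contradiction (Graph.sym G e) (chordless far i≤k)
      ...   | inj₂ eq = inj₂ (sym eq)

      bound : (i : Fin (suc k)) → toℕ i ≤ k
      bound i = s≤s⁻¹ (toℕ<n i)

      c : Fin (suc (suc k)) → V
      c zero = w
      c (suc i) = f (toℕ i)

      c-injective : ∀ {i j} → c i ≡ c j → i ≡ j
      c-injective {zero} {zero} _ = refl
      c-injective {zero} {suc j} eq = contradiction eq (avoids (bound j))
      c-injective {suc i} {zero} eq = contradiction (sym eq) (avoids (bound i))
      c-injective {suc i} {suc j} eq = cong suc (toℕ-injective (injective (bound i) (bound j) eq))

      to : ∀ i j → Adj G (c i) (c j) → Next i j ⊎ Next j i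
      to zero zero e = contradiction e (Graph.irrefl G)
      to zero (suc j) e with neighbour-of-w (bound j) e
      ... | inj₁ j≡0 = inj₁ (inj₁ (cong suc j≡0))
      ... | inj₂ j≡k = inj₂ (inj₂ (cong suc (cong suc j≡k) , refl))
      to (suc i) zero e with neighbour-of-w (bound i) (Graph.sym G e)
      ... | inj₁ i≡0 = inj₂ (inj₁ (cong suc i≡0))
      ... | inj₂ i≡k = inj₁ (inj₂ (cong suc (cong suc i≡k) , refl))
      to (suc i) (suc j) e with consecutive (bound i) (bound j) e
      ... | inj₁ eq = inj₁ (inj₁ (cong suc eq))
      ... | inj₂ eq = inj₂ (inj₁ (cong suc eq))

      next⇒adj : ∀ i j → Next i j → Adj G (c i) (c j)
      next⇒adj zero zero (inj₁ ())
      next⇒adj zero zero (inj₂ (() , _))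
      next⇒adj zero (suc j) (inj₁ eq) =
        subst (λ m → Adj G w (f m)) (sym (ℕ.suc-injective eq)) w∼start
      next⇒adj zero (suc j) (inj₂ (_ , ()))
      next⇒adj (suc i) zero (inj₁ ())
      next⇒adj (suc i) zero (inj₂ (eq , _)) =
        Graph.sym G (subst (λ m → Adj G w (f m)) (sym (ℕ.suc-injective (ℕ.suc-injective eq))) w∼end)
      next⇒adj (suc i) (suc j) (inj₁ eq) = subst (λ m → Adj G (f (toℕ i)) (f m)) (sym (ℕ.suc-injective eq))
        (step path (subst (_≤ k) (ℕ.suc-injective eq) (bound j)))
      next⇒adj (suc i) (suc j) (inj₂ (_ , ()))

    -- The cycle puts `w` at position 0 and `f i` at position `i + 1`. Inner vertices are distant
    -- from `w`, so `w` sees only the two ends, and no other chord is left.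
    induced-cycle : InducedCycle G (suc (suc k))
    induced-cycle = c , c-injective , λ i j → mk⇔ (to i j)
      λ { (inj₁ next) → next⇒adj i j next ; (inj₂ next) → Graph.sym G (next⇒adj j i next) }

  -- Chords of the path are cut off until the path, closed up by w, would be
  -- an induced cycle; a path of length at least two closes to length at least four.
  module _ (chordal : Chordal G) {w a b} (w∼a : Adj G w a) (w∼b : Adj G w b) (a≢b : a ≢ b) where

    private
      shorten : ∀ k f → Acc _<_ k → IsPath (Distant w) a b k f → Adj G a b
      shorten zero f _ path = contradiction (trans (sym (start path)) (end path)) a≢b
      shorten (suc zero) f _ path = subst₂ (Adj G) (start path) (end path) (step path (s≤s z≤n))
      shorten k@(suc (suc _)) f (acc rec) path
        with anyUpTo? (λ j → anyUpTo? (λ i → (suc i ℕ.<? j) ×-dec T? (Graph.adj G (f i) (f j))) j) (suc k)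
      ... | no none = contradiction
              (induced-cycle path w∼a w∼b a≢b
                (λ i+1<j j≤k e → none (_ , s≤s j≤k , _ , <-trans ≤-refl i+1<j , i+1<j , e)))
              (chordal _ (s≤s (s≤s (s≤s (s≤s z≤n)))))
      ... | yes (j , s≤s j≤k , i , _ , i+1<j , e)
            with ℕ.m≤n⇒∃[o]m+o≡n i+1<j | ℕ.m≤n⇒∃[o]m+o≡n j≤k
      -- The chord from `i` to `j = i + 2 + d` skips `d + 1` vertices; with `k = j + l`, a path of
      -- length `i + 1 + l` remains.
      ...   | d , refl | l , refl = shorten (suc i + l) (splice i (suc d) f)
              (rec (subst (suc i + l <_) eq (ℕ.m<m+n (suc i + l) (s≤s z≤n))))
              (splice-path (subst (λ m → IsPath (Distant w) a b m f) (sym eq) path) (ℕ.m≤m+n (suc i) l)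
                (subst (λ m → Adj G (f i) (f m)) (sym (ℕ.+-suc (suc i) d)) e))
              where
              eq : (suc i + l) + suc d ≡ (suc (suc i) + d) + l
              eq = trans (ℕ.+-assoc (suc i) l (suc d))
                     (trans (cong (suc i +_) (trans (ℕ.+-suc l d) (cong suc (ℕ.+-comm l d))))
                       (trans (ℕ.+-suc (suc i) (d + l)) (cong suc (sym (ℕ.+-assoc (suc i) d l)))))

    neighbours-adjacent : Path (Distant w) a b → Adj G a b
    neighbours-adjacent p = shorten _ _ (<-wellFounded _) (isPath p)

-- BFS orderings without labels.

∈-extend⁻ : ∀ {n} (b : Bool) {A : Subset n} {i x} →
  x ∈ (if b then A ∪ ⁅ i ⁆ else A) → x ∈ A ⊎ (T b × x ≡ i)
∈-extend⁻ false x∈ = inj₁ x∈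
∈-extend⁻ true {A} {i} x∈ with x∈p∪q⁻ A ⁅ i ⁆ x∈
... | inj₁ x∈A = inj₁ x∈A
... | inj₂ x∈i = inj₂ (tt , x∈⁅y⁆⇒x≡y i x∈i)

∈-extend⁺ : ∀ {n} (b : Bool) {A : Subset n} {i x} →
  x ∈ A ⊎ (T b × x ≡ i) → x ∈ (if b then A ∪ ⁅ i ⁆ else A)
∈-extend⁺ false (inj₁ x∈A) = x∈A
∈-extend⁺ true (inj₁ x∈A) = x∈p∪q⁺ (inj₁ x∈A)
∈-extend⁺ true {i = i} (inj₂ (_ , refl)) = x∈p∪q⁺ (inj₂ (x∈⁅x⁆ i))

T-does⁻ : ∀ {P : Set} (P? : Dec P) → T (does P?) → P
T-does⁻ (yes p) _ = p

T-does⁺ : ∀ {P : Set} (P? : Dec P) → P → T (does P?)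
T-does⁺ (yes _) _ = tt
T-does⁺ (no ¬p) p = ¬p p

module _ {n : ℕ} (G : Graph (Fin n)) (σ : VertexOrdering n) where

  rank : Fin n → ℕ
  rank u = toℕ (σ ⟨$⟩ˡ u)

  rank-injective : ∀ {u w} → rank u ≡ rank w → u ≡ w
  rank-injective eq =
    trans (sym (inverseʳ σ)) (trans (cong (σ ⟨$⟩ʳ_) (toℕ-injective eq)) (inverseʳ σ))

  ∈-labels⁻ : ∀ k .(k≤n : k ≤ n) y m → m ∈ labels G σ k k≤n y →
    toℕ m < k × toℕ m < rank y × Adj G (σ ⟨$⟩ʳ m) y
  ∈-labels⁻ zero _ y m m∈ = contradiction m∈ ∉⊥
  ∈-labels⁻ (suc k) k<n y m m∈
    with ∈-extend⁻ (does (fromℕ< k<n <? (σ ⟨$⟩ˡ y)) ∧ Graph.adj G (σ ⟨$⟩ʳ fromℕ< k<n) y) m∈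
  ... | inj₁ old = let (m<k , rest) = ∈-labels⁻ k _ y m old in ℕ.m≤n⇒m≤1+n m<k , rest
  ... | inj₂ (t , refl) =
        let (before , adj) = Equivalence.to T-∧ t
        in s≤s (ℕ.≤-reflexive (toℕ-fromℕ< k<n)) , T-does⁻ (_ <? _) before , adj

  ∈-labels⁺ : ∀ k .(k≤n : k ≤ n) y m → toℕ m < k → toℕ m < rank y → Adj G (σ ⟨$⟩ʳ m) y →
    m ∈ labels G σ k k≤n y
  ∈-labels⁺ (suc k) k<n y m m≤k m<y adj =
    ∈-extend⁺ (does (fromℕ< k<n <? (σ ⟨$⟩ˡ y)) ∧ Graph.adj G (σ ⟨$⟩ʳ fromℕ< k<n) y)
      (found (m≤n⇒m<n∨m≡n (s≤s⁻¹ m≤k)))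
    where
    found : toℕ m < k ⊎ toℕ m ≡ k → _
    found (inj₁ m<k) = inj₁ (∈-labels⁺ k _ y m m<k m<y adj)
    found (inj₂ m≡k) with toℕ-injective (trans m≡k (sym (toℕ-fromℕ< k<n)))
    ... | refl = inj₂ (Equivalence.from T-∧ (T-does⁺ (_ <? _) m<y , adj) , refl)

  -- The three-point condition characterising BFS orderings. The choice `j′ = j` is allowed, and
  -- `m = i` is a trivial case.
  Greedy : Fin n → Set
  Greedy i = ∀ j m → j Fin.< i → i Fin.≤ m → Adj G (σ ⟨$⟩ʳ j) (σ ⟨$⟩ʳ m) →
    ∃[ j′ ] j′ Fin.≤ j × Adj G (σ ⟨$⟩ʳ j′) (σ ⟨$⟩ʳ i)

  minimum : ∀ {A : Subset n} → Nonempty A → ∃[ m ] IsMin A m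
  minimum {A} = minimiserFin (_∈? A) toℕ

  -- If the vertex at `i` has no neighbour at a position up to `j`, its label is empty or has its
  -- minimum after `j`. The label of the vertex at `m` contains `j`, so that vertex should have been
  -- preferred.
  bfs⇒greedy : IsBFS G σ → ∀ i → Greedy i
  bfs⇒greedy bfs i j m j<i i≤m adj
    with any? (λ j′ → (j′ ≤ᶠ? j) ×-dec T? (Graph.adj G (σ ⟨$⟩ʳ j′) (σ ⟨$⟩ʳ i)))
  ... | yes found = found
  ... | no none = contradiction (σ ⟨$⟩ʳ m , subst (i Fin.≤_) (sym (inverseˡ σ)) i≤m , prec) (bfs i)
    where
    A = labelAt G σ i (σ ⟨$⟩ʳ i)
    B = labelAt G σ i (σ ⟨$⟩ʳ m)
    j∈B : j ∈ B
    j∈B = ∈-labels⁺ (toℕ i) _ _ j j<i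
      (subst (λ p → j Fin.< p) (sym (inverseˡ σ)) (<-≤-trans j<i i≤m)) adj
    late : ∀ a → a ∈ A → j Fin.< a
    late a a∈A = ≰⇒> λ a≤j → none (a , a≤j , proj₂ (proj₂ (∈-labels⁻ (toℕ i) _ _ a a∈A)))
    prec : A ≺ B
    prec with nonempty? A
    ... | no empty = inj₁ (empty , j , j∈B)
    ... | yes nonempty =
          let (a , a-min) = minimum nonempty
              (b , b-min) = minimum (j , j∈B)
          in inj₂ (a , b , a-min , b-min , ≤-<-trans (proj₂ b-min j j∈B) (late a (proj₁ a-min)))

  -- Every entry of a rival label is matched by an entry at most as large in the label of the chosen
  -- vertex, so the rival label cannot be preferred.
  greedy⇒bfs : (∀ i → Greedy i) → IsBFS G σ
  greedy⇒bfs greedy i (y , i≤y , prec) = refute prec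
    where
    matched : ∀ b → b ∈ labelAt G σ i y → ∃[ a ] a Fin.≤ b × a ∈ labelAt G σ i (σ ⟨$⟩ʳ i)
    matched b b∈ =
      let (b<i , _ , adj) = ∈-labels⁻ (toℕ i) _ y b b∈
          (a , a≤b , adjᵃ) = greedy i b (σ ⟨$⟩ˡ y) b<i i≤y (subst (Adj G _) (sym (inverseʳ σ)) adj)
          a<i = ≤-<-trans a≤b b<i
      in a , a≤b , ∈-labels⁺ (toℕ i) _ _ a a<i (subst (λ p → a Fin.< p) (sym (inverseˡ σ)) a<i) adjᵃ
    refute : ¬ (labelAt G σ i (σ ⟨$⟩ʳ i) ≺ labelAt G σ i y)
    refute (inj₁ (empty , b , b∈)) = let (a , _ , a∈) = matched b b∈ in empty (a , a∈)
    refute (inj₂ (a , b , (_ , a-least) , (b∈ , _) , b<a)) =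
      let (a′ , a′≤b , a′∈) = matched b b∈
      in <-irrefl refl (<-≤-trans b<a (≤-trans (a-least a′ a′∈) a′≤b))

-- From a branch leaf to a centre.

module _ {n : ℕ} (G : Graph (Fin n)) (connected : Connected G) (chordal : Chordal G)
  (σ : VertexOrdering n) (greedy : ∀ i → Greedy G σ i) {r : Fin n} (first : IsFirst G σ r) where

  private
    ρ : Fin n → ℕ
    ρ = rank G σ

    r-first : ∀ {u} → ρ r ≤ ρ u
    r-first {u} = subst (_≤ ρ u) (sym first) z≤n

    first⇒r : ∀ {u} → ρ u ≤ ρ r → u ≡ r
    first⇒r u≤r = rank-injective G σ (≤-antisym u≤r r-first)

    greedyᵛ : ∀ {x y z} → ρ x < ρ y → ρ y ≤ ρ z → Adj G x z → ∃[ x′ ] ρ x′ ≤ ρ x × Adj G x′ y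
    greedyᵛ {x} x<y y≤z e =
      let (j , j≤x , adj) = greedy _ _ _ x<y y≤z
            (subst₂ (Adj G) (sym (inverseʳ σ)) (sym (inverseʳ σ)) e)
      in σ ⟨$⟩ʳ j , subst (λ p → toℕ p ≤ ρ x) (sym (inverseˡ σ)) j≤x ,
         subst (Adj G _) (inverseʳ σ) adj

    crossing : ∀ {a b k s} → Walk G a b k → ρ a < s → s ≤ ρ b →
      ∃[ x ] ∃[ z ] ρ x < s × s ≤ ρ z × Adj G x z
    crossing nil a<s s≤a = contradiction s≤a (ℕ.<⇒≱ a<s)
    crossing {s = s} (cons {v = u} e p) a<s s≤b with ρ u ℕ.<? s
    ... | yes u<s = crossing p u<s s≤b
    ... | no u≮s = _ , _ , a<s , ≮⇒≥ u≮s , e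

    -- A walk from `r` to `u` has an edge leaving the set of vertices before `u`; greediness turns
    -- it into an edge from that set to `u`.
    earlier : ∀ {u} → u ≢ r → ∃[ x ] ρ x < ρ u × Adj G x u
    earlier {u} u≢r =
      let (_ , p) = connected r u
          (x , z , x<u , u≤z , e) = crossing p (≰⇒> (u≢r ∘ first⇒r)) ≤-refl
          (x′ , x′≤x , e′) = greedyᵛ x<u u≤z e
      in x′ , ≤-<-trans x′≤x x<u , e′

    leftmost : ∀ {u} → u ≢ r → ∃[ p ] IsLeftmostNeighbour G σ u p × ρ p < ρ u
    leftmost {u} u≢r =
      let (x , x<u , e) = earlier u≢r
          (p , e′ , least) = minimiserFin (λ y → T? (Graph.adj G u y)) ρ (x , Graph.sym G e)
      in p , (e′ , least) , ≤-<-trans (least x (Graph.sym G e)) x<u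

    -- Repeatedly passing to an earlier neighbour ends at `r` without leaving the ranks below `s`.
    path-to-r : ∀ {P : Fin n → Set} {s} → (∀ z → ρ z < s → P z) →
      ∀ {x u} → Acc _<_ (ρ u) → Adj G x u → ρ u < s → Path G P x r
    path-to-r low {u = u} (acc rec) e u<s with u ≟ᶠ r
    ... | yes refl = edge e
    ... | no u≢r = let (y , y<u , e′) = earlier u≢r in
          cons e (low u u<s) (path-to-r low (rec y<u) (Graph.sym G e′) (<-trans y<u u<s))

    -- The vertices of rank below s form a connected set, so x and y are joined
    -- by a path whose interior is distant from w.
    common-neighbour : ∀ {w x y x′ y′ s} → (∀ z → ρ z < s → Distant G w z) →
      Adj G w x → Adj G w y → x ≢ y →
      Adj G x x′ → ρ x′ < s → Adj G y y′ → ρ y′ < s → Adj G x y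
    common-neighbour low w∼x w∼y x≢y e x′<s e′ y′<s =
      neighbours-adjacent G chordal w∼x w∼y x≢y
        (join G (path-to-r low (<-wellFounded _) e x′<s) (low r (≤-<-trans r-first x′<s))
          (reverse G (path-to-r low (<-wellFounded _) e′ y′<s)))

  branch-leaf⇒centre : ∀ {v} → IsFBranchLeaf G σ v → ∃[ c ] Centre (G ⟦ N G v ⟧) 2 c
  branch-leaf⇒centre {v} (v-not-first , _ , _ , only) with leftmost {v} (λ { refl → v-not-first first })
  ... | p , (v∼p , p-least) , p<v = (p , v∼p) , near
    where
    -- The only tree neighbour of `v` is `p`, so a child of `v` would be `p`. But `p` then has a
    -- neighbour before itself, hence before `v`.
    no-child : ∀ u → ¬ FArc G σ u v
    no-child u arc@(u-not-first , _ , v-least)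
      with refl ← trans (only u (inj₂ arc))
        (sym (only p (inj₁ (v-not-first , v∼p , p-least))))
      = let (y , y<p , e) = earlier {p} (λ { refl → u-not-first first })
        in <-irrefl refl (<-trans p<v (≤-<-trans (v-least y (Graph.sym G e)) y<p))

    -- Vertices before `p` are distant from `v` by the choice of `p`. Since `t` precedes `p`, also
    -- `p` differs from `r` and has an earlier neighbour through which to enter that segment.
    adjacent-to-p : ∀ {u t} → Adj G v u → u ≢ p → Adj G u t → ρ t < ρ p → Adj G u p
    adjacent-to-p v∼u u≢p u∼t t<p =
      let (y , y<p , e) = earlier {p} (λ { refl → ℕ.<⇒≱ t<p r-first })
      in common-neighbour
           (λ z z<p → (λ { refl → <-irrefl refl (<-trans z<p p<v) }) ,
                      λ v∼z → ℕ.<⇒≱ z<p (p-least z v∼z))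
           v∼u v∼p u≢p u∼t t<p (Graph.sym G e) y<p

    near : ∀ u → Within (G ⟦ N G v ⟧) 2 (p , v∼p) u
    near (u , v∼u) with u ≟ᶠ p
    ... | yes refl = 0 , s≤s z≤n ,
          subst (λ e → Walk (G ⟦ N G v ⟧) (p , v∼p) (p , e) 0) (T-irrelevant v∼p v∼u) nil
    ... | no u≢p = via (leftmost u≢r)
      where
      u≢r : u ≢ r
      u≢r refl = u≢p (sym (first⇒r (p-least r v∼u)))

      one : Adj G u p → Within (G ⟦ N G v ⟧) 2 (p , v∼p) (u , v∼u)
      one u∼p = 1 , s≤s (s≤s z≤n) , cons (Graph.sym G u∼p) nil

      via : ∃[ q ] IsLeftmostNeighbour G σ u q × ρ q < ρ u →
        Within (G ⟦ N G v ⟧) 2 (p , v∼p) (u , v∼u)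
      via (q , (u∼q , q-least) , q<u) with ℕ.<-cmp (ρ q) (ρ p)
      ... | tri< q<p _ _ = one (adjacent-to-p v∼u u≢p u∼q q<p)
      ... | tri≈ _ q≡p _ = one (subst (Adj G u) (rank-injective G σ q≡p) u∼q)
      ... | tri> _ _ p<q = 2 , ≤-refl ,
            cons (Graph.sym G q∼p) (cons {u = q , Graph.sym G q∼v} (Graph.sym G u∼q) nil)
        where
        q≢v : q ≢ v
        q≢v refl = no-child u
          ((λ u-first → u≢r (first⇒r (ℕ.≤-reflexive (trans u-first (sym first))))) , u∼q , q-least)

        q∼v : Adj G q v
        q∼v = let (y , y<q , e) = earlier {q} (λ { refl → ℕ.<⇒≱ p<q r-first }) in
          common-neighbour
            (λ z z<q → (λ { refl → <-irrefl refl (<-trans z<q q<u) }) ,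
                       λ u∼z → ℕ.<⇒≱ z<q (q-least z u∼z))
            u∼q (Graph.sym G v∼u) q≢v (Graph.sym G e) y<q v∼p p<q

        q∼p : Adj G q p
        -- As `p` precedes `q` and `q` is no later than `v`, the edge from `p` to `v` forces a
        -- neighbour `t` of `q` no later than `p`.
        q∼p with greedyᵛ p<q (q-least v (Graph.sym G v∼u)) (Graph.sym G v∼p)
        ... | t , t≤p , t∼q with m≤n⇒m<n∨m≡n t≤p
        ...   | inj₁ t<p = adjacent-to-p (Graph.sym G q∼v)
                  (λ { refl → <-irrefl refl p<q }) (Graph.sym G t∼q) t<p
        ...   | inj₂ t≡p = subst (Adj G q) (rank-injective G σ t≡p) (Graph.sym G t∼q)

-- Swapping a later position into position k.

transpose-first : ∀ {n} (k j : Fin n) → transpose k j ⟨$⟩ʳ k ≡ j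
transpose-first k j with k ≟ᶠ k
... | yes _ = refl
... | no k≢k = contradiction refl k≢k

transpose-below : ∀ {n} {k j m : Fin n} → k Fin.≤ j → m Fin.< k → transpose k j ⟨$⟩ʳ m ≡ m
transpose-below {k = k} {j} {m} k≤j m<k with m ≟ᶠ k
... | yes refl = contradiction m<k (<-irrefl refl)
... | no _ with m ≟ᶠ j
...   | yes refl = contradiction k≤j (ℕ.<⇒≱ m<k)
...   | no _ = refl

transpose-above : ∀ {n} {k j m : Fin n} → k Fin.≤ j → k Fin.≤ m → k Fin.≤ (transpose k j ⟨$⟩ʳ m)
transpose-above {k = k} {j} {m} k≤j k≤m with m ≟ᶠ k
... | yes refl = k≤j
... | no _ with m ≟ᶠ j
...   | yes refl = ≤-refl
...   | no _ = k≤m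

-- A BFS ordering from c that delays v.

module _ {n : ℕ} (G : Graph (Fin (suc n))) (c v : Fin (suc n)) (c≢v : c ≢ v) where

  private
    -- The vertex now in position j may be selected at step k: if it is v, then
    -- no other neighbour of c is left.
    DelaysV : VertexOrdering (suc n) → Fin (suc n) → Fin (suc n) → Set
    DelaysV σ k j = σ ⟨$⟩ʳ j ≡ v → ∀ m → k Fin.≤ m → Adj G c (σ ⟨$⟩ʳ m) → σ ⟨$⟩ʳ m ≡ v

    Admissible : VertexOrdering (suc n) → Fin (suc n) → Set
    Admissible σ i = Greedy G σ i × DelaysV σ i i

    -- The conditions on `j` that make position `k` admissible once `j` is swapped into it.
    Choice : VertexOrdering (suc n) → Fin (suc n) → Fin (suc n) → Set
    Choice σ k j = k Fin.≤ j
      × (∀ a m → a Fin.< k → k Fin.≤ m → Adj G (σ ⟨$⟩ʳ a) (σ ⟨$⟩ʳ m) →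
           ∃[ a′ ] a′ Fin.≤ a × Adj G (σ ⟨$⟩ʳ a′) (σ ⟨$⟩ʳ j))
      × DelaysV σ k j

    -- The tie-break: a candidate of least cost is `v` only if there is no other candidate.
    cost : Fin (suc n) → ℕ
    cost u with u ≟ᶠ v
    ... | yes _ = 1
    ... | no _ = 0

    cost-maximal : ∀ {u w} → u ≡ v → cost u ≤ cost w → w ≡ v
    cost-maximal {u} {w} u≡v u≤w with u ≟ᶠ v | w ≟ᶠ v
    ... | no u≢v | _ = contradiction u≡v u≢v
    ... | yes _ | yes w≡v = w≡v
    cost-maximal _ () | yes _ | no _

    -- Take the first numbered position `a` with an unnumbered neighbour, and among its unnumbered
    -- neighbours one of least cost. If no such `a` exists, `k` itself meets both conditions
    -- vacuously.
    choose : ∀ σ k → zero {n = n} Fin.< k → σ ⟨$⟩ʳ zero ≡ c → ∃ (Choice σ k)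
    choose σ k 0<k σ0≡c = by-cases (any? active?)
      where
      Ready : Fin (suc n) → Fin (suc n) → Set
      Ready a m = k Fin.≤ m × Adj G (σ ⟨$⟩ʳ a) (σ ⟨$⟩ʳ m)

      ready? : ∀ a → Decidable (Ready a)
      ready? a m = (k ≤ᶠ? m) ×-dec T? (Graph.adj G (σ ⟨$⟩ʳ a) (σ ⟨$⟩ʳ m))

      Active : Fin (suc n) → Set
      Active a = a Fin.< k × ∃ (Ready a)

      active? : Decidable Active
      active? a = (a <? k) ×-dec any? (ready? a)

      by-cases : Dec (∃ Active) → ∃ (Choice σ k)
      by-cases (no none) =
        k , ≤-refl , (λ a m a<k k≤m e → contradiction (a , a<k , m , k≤m , e) none) , delays
        where
        delays : DelaysV σ k k
        delays _ m k≤m e =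
          contradiction (zero , 0<k , m , k≤m , subst (λ u → Adj G u _) (sym σ0≡c) e) none
      by-cases (yes some) with minimiserFin active? toℕ some
      ... | a , (a<k , ready) , a-least with minimiserFin (ready? a) (cost ∘ (σ ⟨$⟩ʳ_)) ready
      ...   | j , (k≤j , a∼j) , j-cheapest =
              j , k≤j , (λ a′ m a′<k k≤m e → a , a-least a′ (a′<k , m , k≤m , e) , a∼j) , delays
        where
        delays : DelaysV σ k j
        -- A remaining neighbour of `c` forces `a` to be position 0, so it competes with `j` in the
        -- tie-break.
        delays σj≡v m k≤m e = cost-maximal σj≡v (j-cheapest m
          (k≤m , subst (λ u → Adj G u _) (sym (trans (cong (σ ⟨$⟩ʳ_) a≡0) σ0≡c)) e))
          where
          a≤0 : a Fin.≤ zero {n}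
          a≤0 = a-least zero (0<k , m , k≤m , subst (λ u → Adj G u _) (sym σ0≡c) e)
          a≡0 : a ≡ zero
          a≡0 = toℕ-injective (≤-antisym a≤0 z≤n)

    -- The swap fixes positions before `k` and, for each `i` up to `k`, keeps the positions from `i`
    -- on among themselves. Earlier steps therefore stay admissible.
    extend : ∀ σ k → zero {n = n} Fin.< k → σ ⟨$⟩ʳ zero ≡ c → (∀ i → i Fin.< k → Admissible σ i) →
      ∃[ τ ] τ ⟨$⟩ʳ zero ≡ c × (∀ i → i Fin.≤ k → Admissible τ i)
    extend σ k 0<k σ0≡c admissible with choose σ k 0<k σ0≡c
    ... | j , k≤j , chosen , delays =
          τ , τ0≡c , λ i i≤k → by-position (m≤n⇒m<n∨m≡n i≤k)
      where
      τ : VertexOrdering (suc n)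
      τ = transpose k j ∘ₚ σ

      below : ∀ {m} → m Fin.< k → τ ⟨$⟩ʳ m ≡ σ ⟨$⟩ʳ m
      below m<k = cong (σ ⟨$⟩ʳ_) (transpose-below k≤j m<k)

      at : τ ⟨$⟩ʳ k ≡ σ ⟨$⟩ʳ j
      at = cong (σ ⟨$⟩ʳ_) (transpose-first k j)

      moved : ∀ {i m} → i Fin.≤ k → i Fin.≤ m → i Fin.≤ (transpose k j ⟨$⟩ʳ m)
      moved {i} {m} i≤k i≤m with m <? k
      ... | yes m<k = subst (i Fin.≤_) (sym (transpose-below k≤j m<k)) i≤m
      ... | no m≮k = ≤-trans i≤k (transpose-above k≤j (≮⇒≥ m≮k))

      τ0≡c : τ ⟨$⟩ʳ zero ≡ c
      τ0≡c = trans (below 0<k) σ0≡c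

      by-position : ∀ {i} → i Fin.< k ⊎ toℕ i ≡ toℕ k → Admissible τ i
      by-position {i} (inj₁ i<k) =
        let (greedy , delay) = admissible i i<k in
        (λ a m a<i i≤m e →
          let (a′ , a′≤a , e′) = greedy a _ a<i (moved (<⇒≤ i<k) i≤m)
                (subst (λ u → Adj G u (τ ⟨$⟩ʳ m)) (below (<-trans a<i i<k)) e)
          in a′ , a′≤a ,
             subst₂ (Adj G) (sym (below (≤-<-trans a′≤a (<-trans a<i i<k)))) (sym (below i<k)) e′) ,
        (λ τi≡v m i≤m → delay (trans (sym (below i<k)) τi≡v) _ (moved (<⇒≤ i<k) i≤m))
      by-position {i} (inj₂ eq) with refl ← toℕ-injective eq =
        (λ a m a<k k≤m e →
          let (a′ , a′≤a , e′) = chosen a _ a<k (transpose-above k≤j k≤m)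
                (subst (λ u → Adj G u (τ ⟨$⟩ʳ m)) (below a<k) e)
          in a′ , a′≤a , subst₂ (Adj G) (sym (below (≤-<-trans a′≤a a<k))) (sym at) e′) ,
        (λ τk≡v m k≤m → delays (trans (sym at) τk≡v) _ (transpose-above k≤j k≤m))

    admissible-up-to : ∀ k → k < suc n →
      ∃[ σ ] σ ⟨$⟩ʳ zero ≡ c × (∀ i → toℕ i ≤ k → Admissible σ i)
    admissible-up-to zero _ = σ , σ0≡c ,
      -- Nothing precedes position 0, and its vertex `c` is not `v`, so both conditions are vacuous.
      λ { zero _ → (λ _ _ ()) , λ σ0≡v → contradiction (trans (sym σ0≡c) σ0≡v) c≢v }
      where
      σ : VertexOrdering (suc n)
      σ = transpose zero c
      σ0≡c : σ ⟨$⟩ʳ zero ≡ c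
      σ0≡c = transpose-first zero c
    admissible-up-to (suc k) k<n =
      let (σ , σ0≡c , admissible) = admissible-up-to k (<⇒≤ k<n)
          eq = toℕ-fromℕ< k<n
          (τ , τ0≡c , admissible′) = extend σ (fromℕ< k<n) (subst (0 <_) (sym eq) (s≤s z≤n)) σ0≡c
            (λ i i<k → admissible i (s≤s⁻¹ (subst (toℕ i <_) eq i<k)))
      in τ , τ0≡c , λ i i≤k → admissible′ i (subst (toℕ i ≤_) (sym eq) i≤k)

  -- At the position of `v`, admissibility says that no other neighbour of `c` is still unnumbered.
  bfs-from : ∃[ σ ] IsBFS G σ × IsFirst G σ c × (∀ x → Adj G c x → rank G σ x ≤ rank G σ v)
  bfs-from with admissible-up-to n ≤-refl
  ... | σ , σ0≡c , admissible =
        σ , greedy⇒bfs G σ (λ i → proj₁ (admissible i (bound i))) ,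
        cong toℕ (trans (cong (σ ⟨$⟩ˡ_) (sym σ0≡c)) (inverseˡ σ)) ,
        λ x c∼x → ≮⇒≥ λ v<x → <-irrefl (cong (rank G σ) (sym (x≡v x c∼x v<x))) v<x
    where
    bound : (i : Fin (suc n)) → toℕ i ≤ n
    bound i = s≤s⁻¹ (toℕ<n i)

    x≡v : ∀ x → Adj G c x → rank G σ v < rank G σ x → x ≡ v
    x≡v x c∼x v<x = trans (sym (inverseʳ σ)) (proj₂ (admissible _ (bound _)) (inverseʳ σ) (σ ⟨$⟩ˡ x)
      (<⇒≤ v<x) (subst (Adj G c) (sym (inverseʳ σ)) c∼x))

-- From a centre to a branch leaf.

centre⇒branch-leaf : ∀ {n} (G : Graph (Fin (suc n))) {v} {c : ∃[ u ] T (N G v u)} →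
  Centre (G ⟦ N G v ⟧) 2 c → ∃[ σ ] IsBFS G σ × IsFBranchLeaf G σ v
centre⇒branch-leaf G {v} {c , v∼c} centre with bfs-from G c v (λ { refl → Graph.irrefl G v∼c })
... | σ , bfs , first , v-last =
      σ , bfs , v-not-first , c ,
      inj₁ (v-not-first , v∼c , λ u _ → subst (_≤ rank G σ u) (sym first) z≤n) , only
  where
  at-c : ∀ {u} → rank G σ u ≤ rank G σ c → u ≡ c
  at-c {u} u≤c = rank-injective G σ (≤-antisym u≤c (subst (_≤ rank G σ u) (sym first) z≤n))

  v-not-first : ¬ IsFirst G σ v
  v-not-first v-first with refl ← at-c (ℕ.≤-reflexive (trans v-first (sym first))) = Graph.irrefl G v∼c

  -- By length of the walk from `c` to `u`: at 0, `u` is the root; at 1, the first vertex `c` is a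
  -- neighbour of `u` before `v`; at 2, the middle vertex `x` is no later than `v` as a neighbour of
  -- `c`, and is not `v`, so it precedes `v`.
  no-child : ∀ u → ¬ FArc G σ u v
  no-child u (u-not-first , u∼v , v-least) with centre (u , Graph.sym G u∼v)
  ... | 0 , _ , nil = u-not-first first
  ... | 1 , _ , cons c∼u nil with refl ← at-c (v-least c (Graph.sym G c∼u)) = Graph.irrefl G v∼c
  ... | 2 , _ , cons {v = x , v∼x} c∼x (cons x∼u nil)
        with refl ← rank-injective G σ (≤-antisym (v-last x c∼x) (v-least x (Graph.sym G x∼u)))
        = Graph.irrefl G v∼x
  ... | suc (suc (suc _)) , s≤s (s≤s (s≤s ())) , _

  only : ∀ u → FTreeEdge G σ v u → u ≡ c
  only u (inj₁ (_ , _ , u-least)) = at-c (u-least c v∼c)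
  only u (inj₂ arc) = contradiction arc (no-child u)

theorem13 : (n : ℕ) → 2 ≤ n → (G : Graph (Fin n)) → Connected G → Chordal G → (v : Fin n) →
    (∃[ σ ] IsBFS G σ × IsFBranchLeaf G σ v) ⇔ RadiusAtMost (G ⟦ N G v ⟧) 2
theorem13 (suc n) _ G connected chordal v = mk⇔
  (λ (σ , bfs , leaf) → centre⇒radius (proj₂
    -- The root `r` is the vertex in position 0.
    (branch-leaf⇒centre G connected chordal σ (bfs⇒greedy G σ bfs) (cong toℕ (inverseˡ σ {zero})) leaf)))
  (λ radius → centre⇒branch-leaf G (proj₂ (radius⇒centre radius)))
  where open Radius (G ⟦ N G v ⟧) (_≟ₛ_ (N G v)) (searchₛ (N G v))
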